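{- Let $M$ be an o-minimal structure. For any formula $\varphi(x;y)$ in the language of $M$ and any infinite set $A\subseteq M^{|x|}$ that is definable in $M$ (possibly with parameters), it holds that \[ |\{\varphi(A;b) : b\in M^{|y|}\}| \leq |A|. \]
   Context: O-minimality is understood in the sense of van den Dries' book "Tame Topology and O-minimal Structures": $M$ is an expansion of a dense linear order $(M,<)$ without endpoints such that every subset of $M$ definable with parameters is a finite union of points and open intervals with endpoints in $M\cup\{ -\infty,+\infty\}$. "Definable" means definable in $M$, possibly with parameters from $M$. Here $x$ and $y$ are finite tuples of variables, of lengths $|x|$ and $|y|$. For a partitioned formula $\varphi(x;y)$, a set $A\subseteq M^{|x|}$ and $b\in M^{|y|}$, we write $\varphi(A;b)=\{a\in A : M\models \varphi(a;b)\}$. Bars around sets denote cardinality. -}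

module Defs where

open import Data.Empty.Polymorphic using (⊥)
open import Data.Fin.Base using (Fin)
open import Data.List.Base using (List)
open import Data.List.Relation.Unary.Any using (Any)
open import Data.Nat.Base using (ℕ; suc; _+_)
open import Data.Product.Base using (Σ; ∃; ∃-syntax; _×_; proj₁)
open import Data.Sum.Base using (_⊎_)
open import Data.Vec.Base using (Vec; []; _∷_; _++_; head; lookup)
open import Function.Bundles using (Inverse)
open import Level using (Level; _⊔_) renaming (suc to lsuc)
open import Relation.Binary.Bundles using (Setoid)
import Relation.Binary.Construct.Add.Extrema.Strict as Strict
import Relation.Binary.Construct.On as On
import Relation.Binary.Core as Binary
open import Relation.Binary.PropositionalEquality using (_≡_; setoid)
open import Relation.Binary.Structures using (IsDenseLinearOrder)
open import Relation.Nullary.Construct.Add.Extrema using (_±; [_])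
open import Relation.Nullary.Negation.Core using (¬_)
open import Relation.Unary using (Pred; _∈_; _≐_; _∩_)
open import Relation.Unary.Relation.Binary.Equality using (≐-setoid)

private
  variable
    l m p : Level
    n k : ℕ

record Language (l : Level) : Set (lsuc l) where
  field
    Fun : ℕ → Set l
    Rel : ℕ → Set l

open Language public

-- Variables are de Bruijn indices: Term L n and Formula L n have their free
-- variables among n given ones, and a quantifier binds index zero.

data Term (L : Language l) (n : ℕ) : Set l where
  var : Fin n → Term L n
  app : Fun L k → Vec (Term L n) k → Term L n

infix  8 _≈ᶠ_
infixr 7 _∧ᶠ_
infixr 6 _∨ᶠ_
infixr 5 _⇒ᶠ_

data Formula (L : Language l) : ℕ → Set l where
  ⊥ᶠ             : Formula L n
  _≈ᶠ_           : Term L n → Term L n → Formula L n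
  rel            : Rel L k → Vec (Term L n) k → Formula L n
  _∧ᶠ_ _∨ᶠ_ _⇒ᶠ_ : Formula L n → Formula L n → Formula L n
  ∀ᶠ ∃ᶠ          : Formula L (suc n) → Formula L n

record Structure (L : Language l) (m : Level) : Set (l ⊔ lsuc m) where
  field
    Carrier : Set m
    ⟦_⟧ᶠ    : Fun L k → Vec Carrier k → Carrier
    ⟦_⟧ʳ    : Rel L k → Pred (Vec Carrier k) m

open Structure public using (Carrier)

module _ {L : Language l} (M : Structure L m) where

  open Structure M using (⟦_⟧ᶠ; ⟦_⟧ʳ)

  mutual

    eval : Vec (Carrier M) n → Term L n → Carrier M
    eval ρ (var i)    = lookup ρ i
    eval ρ (app f ts) = ⟦ f ⟧ᶠ (evals ρ ts)

    evals : Vec (Carrier M) n → Vec (Term L n) k → Vec (Carrier M) k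
    evals ρ []       = []
    evals ρ (t ∷ ts) = eval ρ t ∷ evals ρ ts

  Sat : Formula L n → Pred (Vec (Carrier M) n) m
  Sat ⊥ᶠ         ρ = ⊥
  Sat (s ≈ᶠ t)   ρ = eval ρ s ≡ eval ρ t
  Sat (rel r ts) ρ = ⟦ r ⟧ʳ (evals ρ ts)
  Sat (φ ∧ᶠ ψ)   ρ = Sat φ ρ × Sat ψ ρ
  Sat (φ ∨ᶠ ψ)   ρ = Sat φ ρ ⊎ Sat ψ ρ
  Sat (φ ⇒ᶠ ψ)   ρ = Sat φ ρ → Sat ψ ρ
  Sat (∀ᶠ φ)     ρ = ∀ x → Sat φ (x ∷ ρ)
  Sat (∃ᶠ φ)     ρ = ∃[ x ] Sat φ (x ∷ ρ)

  -- Definable with parameters c.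
  Definable : Pred (Vec (Carrier M) n) p → Set (l ⊔ m ⊔ p)
  Definable {n = n} S =
    ∃[ k ] Σ (Formula L (n + k)) λ ψ → Σ (Vec (Carrier M) k) λ c →
      S ≐ λ a → Sat ψ (a ++ c)

module _ {C : Set m} (_<_ : Binary.Rel C m) where

  open Strict _<_ using (_<±_)

  data Piece : Set m where
    point    : C → Piece
    interval : (lo hi : C ±) → lo <± hi → Piece

  ⟦_⟧ᵖ : Piece → Pred C m
  ⟦ point a ⟧ᵖ          x = x ≡ a
  ⟦ interval lo hi _ ⟧ᵖ x = (lo <± [ x ]) × ([ x ] <± hi)

  IsFiniteUnion : Pred C p → Set (m ⊔ p)
  IsFiniteUnion S = Σ (List Piece) λ ps → S ≐ λ x → Any (λ q → x ∈ ⟦ q ⟧ᵖ) ps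

record IsOMinimal {L : Language l} (lt : Rel L 2) (M : Structure L m) :
                  Set (l ⊔ lsuc m) where

  infix 4 _<_

  _<_ : Binary.Rel (Carrier M) m
  x < y = Structure.⟦_⟧ʳ M lt (x ∷ y ∷ [])

  field
    isDenseLinearOrder : IsDenseLinearOrder _≡_ _<_
    no-least           : ∀ x → ∃[ y ] y < x
    no-greatest        : ∀ x → ∃[ y ] x < y
    tame               : (S : Pred (Carrier M) m) →
                         Definable M {n = 1} (λ v → head v ∈ S) →
                         IsFiniteUnion _<_ S

-- Members are compared by their underlying element only, so that different
-- proofs of a ∈ A do not contribute to the cardinality of A.
⟪_⟫ : {X : Set m} → Pred X p → Setoid (m ⊔ p) m
⟪_⟫ {X = X} A = On.setoid {B = ∃ A} (setoid X) proj₁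

Infinite : Setoid m p → Set (m ⊔ p)
Infinite S = ¬ (∃[ n ] Inverse S (setoid (Fin n)))

module _ {L : Language l} (M : Structure L m) where

  -- φ(A;b)
  trace : Formula L (n + k) → Pred (Vec (Carrier M) n) p →
          Vec (Carrier M) k → Pred (Vec (Carrier M) n) (m ⊔ p)
  trace φ A b = A ∩ λ a → Sat M φ (a ++ b)

  -- {φ(A;b) : b}, presented as the parameters b, with b and b′ identified
  -- when φ(A;b) and φ(A;b′) have the same elements.
  Traces : Formula L (n + k) → Pred (Vec (Carrier M) n) p →
           Setoid m (m ⊔ p)
  Traces {n = n} {p = p} φ A = On.setoid (≐-setoid (Vec (Carrier M) n) (m ⊔ p)) (trace φ A)

{-# OPTIONS --safe #-}

-- Induction on the length of b, for all infinite definable A at once.  For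
-- b = (x , c), let E_c be the set of boundary points of the sets φ(a;·,c), a ∈ A.
-- If x ∈ E_c, then x is the j-th boundary point of φ(w;·,c) for some w ∈ A, so the
-- trace of (x , c) is determined by j, w and the trace of c under a formula whose
-- objects range over A × A.  If x ∉ E_c, then the trace depends only on the
-- component of the complement of E_c that contains x, and o-minimality leaves
-- finitely many of these, numbered by the boundary points of E_c.  The count
-- closes because |A × A| = |A|, which is Hessenberg's theorem.

module Submission where

open import Defs
open import Axiom.ExcludedMiddle using (ExcludedMiddle)
open import Axiom.Extensionality.Propositional using (Extensionality)
open import Data.Bool.Base using (Bool; true; false; T)
open import Data.Bool.Properties using (T-irrelevant)
open import Data.Empty using (⊥-elim)
open import Data.Fin.Base as Fin using (Fin; zero; suc; _↑ˡ_; _↑ʳ_; splitAt)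
open import Data.List.Base as List using (List; []; _∷_; length; filter; concatMap; deduplicate)
open import Data.List.Membership.Propositional using (_∈_; _∉_)
open import Data.List.Membership.Propositional.Properties
  using (∈-deduplicate⁺; ∈-filter⁺; ∈-lookup; ∈-++⁺ˡ; ∈-++⁺ʳ)
open import Data.List.Properties using (filter-notAll)
open import Data.List.Relation.Unary.All as All using ([]; _∷_)
open import Data.List.Relation.Unary.AllPairs using ([]; _∷_)
open import Data.List.Relation.Unary.Any as Any using (Any; here; there)
open import Data.List.Relation.Unary.Any.Properties using (lookup-index)
open import Data.List.Relation.Unary.Unique.DecPropositional.Properties using (deduplicate-!)
open import Data.List.Relation.Unary.Unique.Propositional using (Unique)
open import Data.Nat.Base as ℕ using (ℕ; zero; suc; _+_)
import Data.Nat.Properties as ℕ using (≤-refl; ≤-pred; <-≤-trans)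
open import Data.Product.Base using (Σ; ∃; ∃-syntax; _×_; _,_; proj₁; proj₂; map₂; uncurry; swap)
open import Data.Product.Function.NonDependent.Propositional using (_×-⇔_)
open import Data.Product.Properties using (,-injective)
open import Data.Sum.Base using (_⊎_; inj₁; inj₂; [_,_]′)
open import Data.Sum.Function.Propositional using (_⊎-⇔_)
open import Data.Unit.Base using (tt)
open import Data.Vec.Base using (Vec; []; _∷_; _++_; lookup)
open import Data.Vec.Properties using (lookup-++ˡ; lookup-++ʳ; lookup-splitAt)
open import Function.Base using (_∘_; id; const; case_of_)
open import Function.Bundles using (_↣_; _↔_; _⇔_; mk↣; mk⇔; mk↔ₛ′; Injection; Inverse; Equivalence)
open import Function.Construct.Composition using (_⇔-∘_)
open import Function.Construct.Identity using (⇔-id)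
open import Level using (Level; _⊔_)
open import Relation.Binary.Bundles using (Setoid)
open import Relation.Binary.Construct.Add.Extrema.Strict using (⊥±<[_]; [_]; [_]<⊤±)
import Relation.Binary.Construct.Add.Supremum.Strict as ⁺ using ([_])
open import Relation.Binary.Definitions using (DecidableEquality; tri<; tri≈; tri>)
open import Relation.Binary.PropositionalEquality
  using (_≡_; _≢_; refl; sym; trans; cong; cong₂; subst; setoid)
open import Relation.Binary.Structures using (IsDenseLinearOrder)
open import Relation.Nullary using (Dec; yes; no; ¬_; contradiction)
open import Relation.Nullary.Construct.Add.Extrema using (_±; ⊥±; ⊤±; [_])
open import Relation.Nullary.Decidable using (True; toWitness; fromWitness; decidable-stable; isYes)
open import Relation.Unary using (Pred; _≐_)

-- The definability of A enters through E_c: its definition quantifies over A, and only a definable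
-- E_c is tame. E_c itself may be infinite, so a point of it is named by a witness w and a rank j
-- rather than by its place in a finite list. The witness cannot stay among the parameters, because
-- eliminating x has to shorten the parameter tuple; it moves to the object side, which is what
-- turns A into A × A. The rank stays outside the formulas: "x is the j-th boundary point" is
-- first-order for each separate j, and the number of boundary points may vary with c. Hence j is
-- stored in the code of a trace, which is affordable because ℕ embeds in A.

private
  variable
    a b u p l m ℓ : Level
    A U : Set a
    n k r : ℕ

-- Pairing of natural numbers and lists without repetition

-- The square of a + b is followed by 2 (a + b) numbers that are not squares.
ℕ×ℕ↣ℕ : (ℕ × ℕ) ↣ ℕ
ℕ×ℕ↣ℕ = mk↣ {to = λ (a , b) → code a b} λ {p} {q} → inj p q
  where
  open import Data.Nat.Base using (_*_; _<_)
  open import Data.Nat.Properties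

  code : ℕ → ℕ → ℕ
  code a b = (a + b) * (a + b) + a

  sep : ∀ a b a′ b′ → a + b < a′ + b′ → code a b < code a′ b′
  sep a b a′ b′ s<s′ = begin-strict
    s * s + a            ≤⟨ +-monoʳ-≤ (s * s) (m≤m+n a b) ⟩
    s * s + s            ≡⟨ +-comm (s * s) s ⟩
    suc s * s            <⟨ *-monoʳ-< (suc s) (n<1+n s) ⟩
    suc s * suc s        ≤⟨ *-mono-≤ s<s′ s<s′ ⟩
    (a′ + b′) * (a′ + b′) ≤⟨ m≤m+n _ a′ ⟩
    code a′ b′           ∎
    where
    open ≤-Reasoning
    s = a + b

  inj : ∀ p q → code (proj₁ p) (proj₂ p) ≡ code (proj₁ q) (proj₂ q) → p ≡ q
  inj (a , b) (a′ , b′) eq with <-cmp (a + b) (a′ + b′)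
  ... | tri< lt _ _ = contradiction eq (<⇒≢ (sep a b a′ b′ lt))
  ... | tri> _ _ gt = contradiction (sym eq) (<⇒≢ (sep a′ b′ a b gt))
  ... | tri≈ _ s≡s′ _ = cong₂ _,_ a≡a′ (+-cancelˡ-≡ a b b′ (trans s≡s′ (cong (_+ b′) (sym a≡a′))))
    where
    a≡a′ : a ≡ a′
    a≡a′ = +-cancelˡ-≡ _ a a′ (trans eq (cong (λ s → s * s + a′) (sym s≡s′)))

Unique⇒lookup-injective : {xs : List A} → Unique xs → ∀ i j →
                          List.lookup xs i ≡ List.lookup xs j → i ≡ j
Unique⇒lookup-injective (x∉ ∷ u) zero    zero    eq = refl
Unique⇒lookup-injective (x∉ ∷ u) zero    (suc j) eq = ⊥-elim (All.lookup x∉ (∈-lookup j) eq)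
Unique⇒lookup-injective (x∉ ∷ u) (suc i) zero    eq = ⊥-elim (All.lookup x∉ (∈-lookup i) (sym eq))
Unique⇒lookup-injective (x∉ ∷ u) (suc i) (suc j) eq = cong suc (Unique⇒lookup-injective u i j eq)

-- Choice and Boolean subsets

-- Excluded middle decides arbitrary types, not only propositions, so it is a
-- global choice operator.  Subsets are Boolean-valued: this makes them small and
-- extensional, so that choices depending on a subset depend only on its elements.
module Classical
  (em : ∀ {ℓ} → ExcludedMiddle ℓ) (ext : ∀ {a b} → Extensionality a b)
  where

  Subset : Set u → Set u
  Subset U = U → Bool

  compr : (U → Set ℓ) → Subset U
  compr P x = isYes (em {P = P x})

  compr⁺ : (P : U → Set ℓ) {x : U} → P x → T (compr P x)
  compr⁺ P = fromWitness

  compr⁻ : (P : U → Set ℓ) {x : U} → T (compr P x) → P x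
  compr⁻ P = toWitness

  infix 4 _⊆_
  _⊆_ : Subset U → Subset U → Set _
  S ⊆ S′ = ∀ {x} → T (S x) → T (S′ x)

  ⊆-antisym : {S S′ : Subset U} → S ⊆ S′ → S′ ⊆ S → S ≡ S′
  ⊆-antisym {S = S} {S′} p q = ext λ x → bool (S x) (S′ x) p q
    where
    bool : ∀ x y → (T x → T y) → (T y → T x) → x ≡ y
    bool false false _ _ = refl
    bool true  true  _ _ = refl
    bool false true  _ q = ⊥-elim (q tt)
    bool true  false p _ = ⊥-elim (p tt)

  ¬∀⇒∃¬ : {P : A → Set ℓ} → ¬ (∀ x → P x) → ∃[ x ] ¬ P x
  ¬∀⇒∃¬ {P = P} ¬∀ with em {P = ∃[ x ] ¬ P x}
  ... | yes p = p
  ... | no ¬p = contradiction (λ x → case em {P = P x} of λ where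
                  (yes px) → px
                  (no ¬px) → contradiction (x , ¬px) ¬p) ¬∀

  ⋃ : Subset (Subset U) → Subset U
  ⋃ 𝒮 = compr λ x → ∃[ S ] T (𝒮 S) × T (S x)

  ⋃⁺ : ∀ {𝒮 : Subset (Subset U)} {S x} → T (𝒮 S) → T (S x) → T (⋃ 𝒮 x)
  ⋃⁺ S∈𝒮 x∈S = fromWitness (_ , S∈𝒮 , x∈S)

  ⋃⁻ : ∀ {𝒮 : Subset (Subset U)} {x} → T (⋃ 𝒮 x) → ∃[ S ] T (𝒮 S) × T (S x)
  ⋃⁻ = toWitness

  Chain : Subset (Subset U) → Set _
  Chain 𝒮 = ∀ {S S′} → T (𝒮 S) → T (𝒮 S′) → S ⊆ S′ ⊎ S′ ⊆ S

  -- Zorn's lemma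

  module Zorn {U : Set u} (𝓕 : Subset U → Set ℓ)
    (⋃-closed : ∀ 𝒮 → ∃[ S ] T (𝒮 S) → (∀ {S} → T (𝒮 S) → 𝓕 S) → Chain 𝒮 → 𝓕 (⋃ 𝒮))
    {S₀ : Subset U} (S₀∈𝓕 : 𝓕 S₀)
    where

    Larger : Subset U → Set _
    Larger S = ∃[ S′ ] 𝓕 S′ × S ⊆ S′ × ¬ (S′ ⊆ S)

    -- The decision is an argument of its own so that proofs can generalise over it and match;
    -- `next` then fixes it to `em`, which acts as the choice function.
    next′ : ∀ S → Dec (Larger S) → Subset U
    next′ S (yes (S′ , _)) = S′
    next′ S (no _)         = S

    next : Subset U → Subset U
    next S = next′ S em

    next-inflationary : ∀ {S} → S ⊆ next S
    next-inflationary {S} = go em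
      where
      go : ∀ d → S ⊆ next′ S d
      go (yes (_ , _ , S⊆S′ , _)) = S⊆S′
      go (no _)                   = id

    next-closed : ∀ {S} → 𝓕 S → 𝓕 (next S)
    next-closed {S} S∈𝓕 = go em
      where
      go : ∀ d → 𝓕 (next′ S d)
      go (yes (_ , S′∈𝓕 , _)) = S′∈𝓕
      go (no _)               = S∈𝓕

    next-fixed⇒maximal : ∀ {S} → next S ⊆ S → ∀ {S′} → 𝓕 S′ → S ⊆ S′ → S′ ⊆ S
    next-fixed⇒maximal {S} fixed {S′} S′∈𝓕 S⊆S′ = go em fixed
      where
      go : ∀ d → next′ S d ⊆ S → S′ ⊆ S
      go (yes (_ , _ , _ , S″⊈S)) S″⊆S = contradiction (λ {x} → S″⊆S {x}) S″⊈S
      go (no ¬larger)             _ {x} with em {P = S′ ⊆ S}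
      ... | yes S′⊆S = S′⊆S {x}
      ... | no  S′⊈S = contradiction (S′ , S′∈𝓕 , (λ {y} → S⊆S′ {y}) , S′⊈S) ¬larger

    data Tower : Subset U → Set u where
      base  : Tower S₀
      step  : ∀ {S} → Tower S → Tower (next S)
      union : ∀ 𝒮 → ∃[ S ] T (𝒮 S) → (∀ {S} → T (𝒮 S) → Tower S) → Tower (⋃ 𝒮)

    S₀⊆Tower : ∀ {S} → Tower S → S₀ ⊆ S
    S₀⊆Tower base                      = id
    S₀⊆Tower (step t)                  = next-inflationary ∘ S₀⊆Tower t
    S₀⊆Tower (union 𝒮 (_ , S∈𝒮) tower) = ⋃⁺ {𝒮 = 𝒮} S∈𝒮 ∘ S₀⊆Tower (tower S∈𝒮)

    -- S is comparable with the whole tower once the tower below S steps up to S.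
    Regular : Subset U → Set u
    Regular S = ∀ {R} → Tower R → R ⊆ S → S ≡ R ⊎ next R ⊆ S

    ⋃-⊆? : ∀ (𝒮 : Subset (Subset U)) S →
           ⋃ 𝒮 ⊆ S ⊎ ∃[ R ] T (𝒮 R) × ¬ (R ⊆ S)
    ⋃-⊆? 𝒮 S with em {P = ∃[ R ] T (𝒮 R) × ¬ (R ⊆ S)}
    ... | yes p = inj₂ p
    ... | no ¬p = inj₁ λ x∈⋃ → let R , R∈𝒮 , x∈R = ⋃⁻ {𝒮 = 𝒮} x∈⋃ in
                  case em {P = R ⊆ S} of λ where
                    (yes R⊆S) → R⊆S x∈R
                    (no  R⊈S) → contradiction (R , R∈𝒮 , R⊈S) ¬p

    -- Climbing the tower, R cannot jump over S: as long as R is inside S, regularity keeps `next R`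
    -- inside S or says that R has reached S. In a union, a member that is not inside S already
    -- contains `next S`.
    regular⇒comparable : ∀ {S} → Tower S → Regular S → ∀ {R} → Tower R → next S ⊆ R ⊎ R ⊆ S
    regular⇒comparable tS reg base = inj₂ (S₀⊆Tower tS)
    regular⇒comparable tS reg (step tR) with regular⇒comparable tS reg tR
    ... | inj₁ S⁺⊆R = inj₁ (next-inflationary ∘ S⁺⊆R)
    ... | inj₂ R⊆S with reg tR R⊆S
    ...   | inj₁ refl = inj₁ id
    ...   | inj₂ R⁺⊆S = inj₂ R⁺⊆S
    regular⇒comparable {S} tS reg (union 𝒮 _ tower) with ⋃-⊆? 𝒮 S
    ... | inj₁ ⋃⊆S = inj₂ ⋃⊆S
    ... | inj₂ (R , R∈𝒮 , R⊈S) with regular⇒comparable tS reg (tower R∈𝒮)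
    ...   | inj₁ S⁺⊆R = inj₁ (⋃⁺ {𝒮 = 𝒮} R∈𝒮 ∘ S⁺⊆R)
    ...   | inj₂ R⊆S  = contradiction (λ {x} → R⊆S {x}) R⊈S

    -- Induction on the stage S, using the comparability that regularity of earlier stages provides.
    -- In a union that is not inside R, some member is not inside R either; that member then
    -- contains R properly, hence also `next R`.
    regular : ∀ {S} → Tower S → Regular S
    regular base tR R⊆S₀ = inj₁ (⊆-antisym (S₀⊆Tower tR) R⊆S₀)
    regular (step tS) tR R⊆S⁺ with regular⇒comparable tS (regular tS) tR
    ... | inj₁ S⁺⊆R = inj₁ (⊆-antisym S⁺⊆R R⊆S⁺)
    ... | inj₂ R⊆S with regular tS tR R⊆S
    ...   | inj₁ refl = inj₂ id
    ...   | inj₂ R⁺⊆S = inj₂ (next-inflationary ∘ R⁺⊆S)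
    regular (union 𝒮 S∈𝒮 tower) {R} tR R⊆⋃ with ⋃-⊆? 𝒮 R
    ... | inj₁ ⋃⊆R = inj₁ (⊆-antisym ⋃⊆R R⊆⋃)
    ... | inj₂ (S , S∈𝒮 , S⊈R) with regular⇒comparable (tower S∈𝒮) (regular (tower S∈𝒮)) tR
    ...   | inj₁ S⁺⊆R = contradiction (λ {x} → S⁺⊆R {x} ∘ next-inflationary) S⊈R
    ...   | inj₂ R⊆S with regular (tower S∈𝒮) tR R⊆S
    ...     | inj₁ refl = contradiction (λ {x} → id) S⊈R
    ...     | inj₂ R⁺⊆S = inj₂ (⋃⁺ {𝒮 = 𝒮} S∈𝒮 ∘ R⁺⊆S)

    Tower-chain : ∀ {S R} → Tower S → Tower R → S ⊆ R ⊎ R ⊆ S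
    Tower-chain tS tR with regular⇒comparable tS (regular tS) tR
    ... | inj₁ S⁺⊆R = inj₁ (S⁺⊆R ∘ next-inflationary)
    ... | inj₂ R⊆S  = inj₂ R⊆S

    Tower⇒𝓕 : ∀ {S} → Tower S → 𝓕 S
    Tower⇒𝓕 base = S₀∈𝓕
    Tower⇒𝓕 (step t) = next-closed (Tower⇒𝓕 t)
    Tower⇒𝓕 (union 𝒮 S∈𝒮 tower) = ⋃-closed 𝒮 S∈𝒮 (Tower⇒𝓕 ∘ tower)
      (λ S∈𝒮 R∈𝒮 → Tower-chain (tower S∈𝒮) (tower R∈𝒮))

    maximal : ∃[ S ] 𝓕 S × S₀ ⊆ S × (∀ {S′} → 𝓕 S′ → S ⊆ S′ → S′ ⊆ S)
    -- The union of the whole tower is again a stage, so its successor is a stage and lies inside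
    -- it: this is a fixed point of `next`.
    maximal = ⋃ 𝒯 , Tower⇒𝓕 top , S₀⊆Tower top ,
              next-fixed⇒maximal (⋃⁺ {𝒮 = 𝒯} (compr⁺ Tower (step top)))
      where
      𝒯 = compr Tower
      top : Tower (⋃ 𝒯)
      top = union 𝒯 (S₀ , compr⁺ Tower base) (compr⁻ Tower)

  -- Reduces a closure condition on the union of a chain to a single member; the conditions used
  -- below speak of at most two elements at a time.
  common-member : ∀ {𝒮 : Subset (Subset U)} {x y} → Chain 𝒮 → T (⋃ 𝒮 x) → T (⋃ 𝒮 y) →
                  ∃[ S ] T (𝒮 S) × T (S x) × T (S y)
  common-member {𝒮 = 𝒮} chain x∈⋃ y∈⋃ with ⋃⁻ {𝒮 = 𝒮} x∈⋃ | ⋃⁻ {𝒮 = 𝒮} y∈⋃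
  ... | S , S∈𝒮 , x∈S | S′ , S′∈𝒮 , y∈S′ with chain S∈𝒮 S′∈𝒮
  ...   | inj₁ S⊆S′ = S′ , S′∈𝒮 , S⊆S′ x∈S , y∈S′
  ...   | inj₂ S′⊆S = S , S∈𝒮 , x∈S , S′⊆S y∈S′

  -- Comparability of cardinals and countable subsets of infinite sets

  record IsPartialInjection {A : Set a} {B : Set b} (R : Subset (A × B)) : Set (a ⊔ b) where
    field
      functional : ∀ {x y y′} → T (R (x , y)) → T (R (x , y′)) → y ≡ y′
      injective  : ∀ {x x′ y} → T (R (x , y)) → T (R (x′ , y)) → x ≡ x′

  maximal-partial-injection : ∀ (A : Set a) (B : Set b) → ∃[ R ] IsPartialInjection {A = A} {B} R ×
    (∀ {S} → IsPartialInjection S → R ⊆ S → S ⊆ R)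
  maximal-partial-injection A B =
    let R , R-pinj , _ , R-max = Zorn.maximal IsPartialInjection
          (λ 𝒮 _ 𝒮⊆ chain → record
            { functional = λ p q → let S , S∈𝒮 , p′ , q′ = common-member {𝒮 = 𝒮} chain p q in
                                   functional (𝒮⊆ S∈𝒮) p′ q′
            ; injective  = λ p q → let S , S∈𝒮 , p′ , q′ = common-member {𝒮 = 𝒮} chain p q in
                                   injective (𝒮⊆ S∈𝒮) p′ q′
            })
          {S₀ = const false} (record { functional = λ () ; injective = λ () })
    in R , R-pinj , R-max
    where open IsPartialInjection

  -- A maximal partial injection is defined everywhere or hits everything: otherwise an unmatched
  -- pair `(x₀ , y₀)` could be added to it.
  ↣-total : ∀ (A : Set a) (B : Set b) → (A ↣ B) ⊎ (B ↣ A)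
  ↣-total A B = go em em
    where
    R : Subset (A × B)
    R = proj₁ (maximal-partial-injection A B)
    open IsPartialInjection (proj₁ (proj₂ (maximal-partial-injection A B)))

    module _ (x₀ : A) (y₀ : B) where

      R′ : A × B → Set _
      R′ p = T (R p) ⊎ p ≡ (x₀ , y₀)

      unmatched-pair : ¬ (∃[ y ] T (R (x₀ , y))) → ¬ ¬ (∃[ x ] T (R (x , y₀)))
      unmatched-pair x₀∉ y₀∉ = x₀∉ (y₀ , proj₂ (proj₂ (maximal-partial-injection A B))
        (record { functional = λ p q → functional′ (compr⁻ R′ p) (compr⁻ R′ q)
                ; injective  = λ p q → injective′ (compr⁻ R′ p) (compr⁻ R′ q) })
        (compr⁺ R′ ∘ inj₁) (compr⁺ R′ (inj₂ refl)))
        where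
        functional′ : ∀ {x y y′} → R′ (x , y) → R′ (x , y′) → y ≡ y′
        functional′ (inj₁ p)    (inj₁ q)    = functional p q
        functional′ (inj₁ p)    (inj₂ refl) = contradiction (_ , p) x₀∉
        functional′ (inj₂ refl) (inj₁ q)    = contradiction (_ , q) x₀∉
        functional′ (inj₂ refl) (inj₂ refl) = refl

        injective′ : ∀ {x x′ y} → R′ (x , y) → R′ (x′ , y) → x ≡ x′
        injective′ (inj₁ p)    (inj₁ q)    = injective p q
        injective′ (inj₁ p)    (inj₂ refl) = contradiction (_ , p) y₀∉
        injective′ (inj₂ refl) (inj₁ q)    = contradiction (_ , q) y₀∉
        injective′ (inj₂ refl) (inj₂ refl) = refl

    go : Dec (∀ x → ∃[ y ] T (R (x , y))) → Dec (∀ y → ∃[ x ] T (R (x , y))) → (A ↣ B) ⊎ (B ↣ A)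
    go (yes f) _ = inj₁ (mk↣ {to = proj₁ ∘ f} λ {x} {x′} eq →
      injective (proj₂ (f x)) (subst (λ y → T (R (x′ , y))) (sym eq) (proj₂ (f x′))))
    go (no _) (yes g) = inj₂ (mk↣ {to = proj₁ ∘ g} λ {y} {y′} eq →
      functional (proj₂ (g y)) (subst (λ x → T (R (x , y′))) (sym eq) (proj₂ (g y′))))
    go (no ¬f) (no ¬g) =
      let x₀ , x₀∉ = ¬∀⇒∃¬ ¬f ; y₀ , y₀∉ = ¬∀⇒∃¬ ¬g in
      contradiction y₀∉ (unmatched-pair x₀ y₀ x₀∉)

  infinite⇒ℕ↣ : ¬ (∃[ n ] A ↔ Fin n) → ℕ ↣ A
  infinite⇒ℕ↣ {A = X} infinite = mk↣ {to = elem} λ {k} {n} → elem-injective k n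
    where
    open import Data.Nat.Base using (_<_; s≤s⁻¹)
    open import Data.Nat.Properties using (<-cmp; m≤n⇒m<n∨m≡n)

    _≟_ : DecidableEquality X
    x ≟ y = em

    fresh : ∀ xs → ∃[ x ] x ∉ xs
    fresh xs = ¬∀⇒∃¬ λ all∈ →
      let ys = deduplicate _≟_ xs
          all∈ys = λ x → ∈-deduplicate⁺ _≟_ (all∈ x)
      in infinite (length ys , mk↔ₛ′ (Any.index ∘ all∈ys) (List.lookup ys)
           (λ i → Unique⇒lookup-injective (deduplicate-! _≟_ xs) _ _
                    (sym (lookup-index (all∈ys (List.lookup ys i)))))
           (λ x → sym (lookup-index (all∈ys x))))

    initial : ℕ → List X
    initial zero    = []
    initial (suc n) = proj₁ (fresh (initial n)) ∷ initial n

    elem : ℕ → X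
    elem n = proj₁ (fresh (initial n))

    elem∈ : ∀ {k n} → k < n → elem k ∈ initial n
    elem∈ {k} {suc n} k<1+n with m≤n⇒m<n∨m≡n (s≤s⁻¹ k<1+n)
    ... | inj₁ k<n  = there (elem∈ k<n)
    ... | inj₂ refl = here refl

    elem-≢ : ∀ {k n} → k < n → elem k ≢ elem n
    elem-≢ {n = n} k<n eq = proj₂ (fresh (initial n)) (subst (_∈ initial n) eq (elem∈ k<n))

    elem-injective : ∀ k n → elem k ≡ elem n → k ≡ n
    elem-injective k n eq with <-cmp k n
    ... | tri< k<n _ _ = contradiction eq (elem-≢ k<n)
    ... | tri≈ _ k≡n _ = k≡n
    ... | tri> _ _ n<k = contradiction (sym eq) (elem-≢ n<k)

  -- Hessenberg's theorem

  -- Take a maximal subset Y of X with a pairing function.  If Y embedded in its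
  -- complement, the pairing would extend to Y and its image, so the complement
  -- embeds in Y, and X embeds in two disjoint copies of Y inside Y × Y.
  module Square {X : Set u} (seed : ℕ ↣ X) where

    open Injection using (to) renaming (injective to inj)

    -- Reading the domain off the diagonal makes it a function of R, so Zorn's lemma is applied to
    -- graphs alone, with no separate component for the subset Y.
    Dom : Subset (X × X × X) → X → Set _
    Dom R x = ∃[ z ] T (R (x , x , z))

    -- R is the graph of an injection Dom R × Dom R ↣ Dom R.
    record IsPairing (R : Subset (X × X × X)) : Set u where
      field
        total      : ∀ {x y} → Dom R x → Dom R y → ∃[ z ] T (R (x , y , z))
        domˡ       : ∀ {x y z} → T (R (x , y , z)) → Dom R x
        domʳ       : ∀ {x y z} → T (R (x , y , z)) → Dom R y
        codom      : ∀ {x y z} → T (R (x , y , z)) → Dom R z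
        functional : ∀ {x y z z′} → T (R (x , y , z)) → T (R (x , y , z′)) → z ≡ z′
        injective  : ∀ {x y x′ y′ z} → T (R (x , y , z)) → T (R (x′ , y′ , z)) →
                     (x , y) ≡ (x′ , y′)

    ⋃-isPairing : ∀ 𝒮 → (∀ {S} → T (𝒮 S) → IsPairing S) → Chain 𝒮 → IsPairing (⋃ 𝒮)
    ⋃-isPairing 𝒮 𝒮⊆ chain = record
      { total      = λ (_ , p) (_ , q) →
                     let S , S∈𝒮 , p′ , q′ = common-member {𝒮 = 𝒮} chain p q in
                     map₂ (⋃⁺ {𝒮 = 𝒮} S∈𝒮) (total (𝒮⊆ S∈𝒮) (_ , p′) (_ , q′))
      ; domˡ       = λ p → let S , S∈𝒮 , p′ = ⋃⁻ {𝒮 = 𝒮} p in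
                     map₂ (⋃⁺ {𝒮 = 𝒮} S∈𝒮) (domˡ (𝒮⊆ S∈𝒮) p′)
      ; domʳ       = λ p → let S , S∈𝒮 , p′ = ⋃⁻ {𝒮 = 𝒮} p in
                     map₂ (⋃⁺ {𝒮 = 𝒮} S∈𝒮) (domʳ (𝒮⊆ S∈𝒮) p′)
      ; codom      = λ p → let S , S∈𝒮 , p′ = ⋃⁻ {𝒮 = 𝒮} p in
                     map₂ (⋃⁺ {𝒮 = 𝒮} S∈𝒮) (codom (𝒮⊆ S∈𝒮) p′)
      ; functional = λ p q → let S , S∈𝒮 , p′ , q′ = common-member {𝒮 = 𝒮} chain p q in
                     functional (𝒮⊆ S∈𝒮) p′ q′
      ; injective  = λ p q → let S , S∈𝒮 , p′ , q′ = common-member {𝒮 = 𝒮} chain p q in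
                     injective (𝒮⊆ S∈𝒮) p′ q′
      }
      where open IsPairing

    module _ {W : Set a} (e : W ↣ X) (op : (W × W) ↣ W) where

      -- Transports a pairing on W to the image of W in X. It serves twice: with W = ℕ for the
      -- starting point of Zorn's lemma, and with W = Y × Bool for the enlargement that contradicts
      -- maximality.
      Graph : X × X × X → Set _
      Graph (x , y , z) = ∃[ p ] ∃[ q ] x ≡ to e p × y ≡ to e q × z ≡ to e (to op (p , q))

      graph : Subset (X × X × X)
      graph = compr Graph

      graph-dom : ∀ p → Dom graph (to e p)
      graph-dom p = _ , compr⁺ Graph (p , p , refl , refl , refl)

      graph-dom⁻ : ∀ {x} → Dom graph x → ∃[ p ] x ≡ to e p
      graph-dom⁻ (_ , r) = let p , _ , x≡ , _ = compr⁻ Graph r in p , x≡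

      graph-isPairing : IsPairing graph
      graph-isPairing = record
        { total      = λ x∈ y∈ → let p , x≡ = graph-dom⁻ x∈ ; q , y≡ = graph-dom⁻ y∈ in
                       _ , compr⁺ Graph (p , q , x≡ , y≡ , refl)
        ; domˡ       = λ r → let p , q , x≡ , y≡ , z≡ = compr⁻ Graph r in
                       subst (Dom graph) (sym x≡) (graph-dom p)
        ; domʳ       = λ r → let p , q , x≡ , y≡ , z≡ = compr⁻ Graph r in
                       subst (Dom graph) (sym y≡) (graph-dom q)
        ; codom      = λ r → let p , q , x≡ , y≡ , z≡ = compr⁻ Graph r in
                       subst (Dom graph) (sym z≡) (graph-dom (to op (p , q)))
        ; functional = λ r s → functional′ (compr⁻ Graph r) (compr⁻ Graph s)
        ; injective  = λ r s → injective′ (compr⁻ Graph r) (compr⁻ Graph s)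
        }
        where
        functional′ : ∀ {x y z z′} → Graph (x , y , z) → Graph (x , y , z′) → z ≡ z′
        functional′ (p , q , x≡ , y≡ , z≡) (p′ , q′ , x≡′ , y≡′ , z≡′) =
          trans z≡ (trans (cong (to e ∘ to op)
            (cong₂ _,_ (inj e (trans (sym x≡) x≡′)) (inj e (trans (sym y≡) y≡′)))) (sym z≡′))

        injective′ : ∀ {x y x′ y′ z} → Graph (x , y , z) → Graph (x′ , y′ , z) →
                     (x , y) ≡ (x′ , y′)
        injective′ (p , q , x≡ , y≡ , z≡) (p′ , q′ , x≡′ , y≡′ , z≡′)
          with refl ← inj op (inj e (trans (sym z≡) z≡′)) =
          cong₂ _,_ (trans x≡ (sym x≡′)) (trans y≡ (sym y≡′))

    X×X↣X : (X × X) ↣ X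
    X×X↣X with Zorn.maximal IsPairing (λ 𝒮 _ → ⋃-isPairing 𝒮) (graph-isPairing seed ℕ×ℕ↣ℕ)
    ... | R , R-pairing , seed⊆R , R-max = case ↣-total Y Yᶜ of λ where
          (inj₁ j) → contradiction j Y↣̸Yᶜ
          (inj₂ i) → square i
      where
      open IsPairing R-pairing

      Y Yᶜ : Set _
      Y  = Σ X λ x → True (em {P = Dom R x})
      Yᶜ = Σ X λ x → True (em {P = ¬ Dom R x})

      Y-≡ : {p q : Y} → proj₁ p ≡ proj₁ q → p ≡ q
      Y-≡ refl = cong (_ ,_) (T-irrelevant _ _)

      Yᶜ-≡ : {p q : Yᶜ} → proj₁ p ≡ proj₁ q → p ≡ q
      Yᶜ-≡ refl = cong (_ ,_) (T-irrelevant _ _)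

      dom : (p : Y) → Dom R (proj₁ p)
      dom (_ , t) = toWitness t

      pairing : (Y × Y) ↣ Y
      pairing = mk↣ {to = λ (p , q) → let z , r = total (dom p) (dom q) in z , fromWitness (codom r)}
        λ {(p , q)} {(p′ , q′)} eq →
          let r  = proj₂ (total (dom p) (dom q))
              r′ = proj₂ (total (dom p′) (dom q′))
              x≡ , y≡ = ,-injective (injective r
                (subst (λ z → T (R (proj₁ p′ , proj₁ q′ , z))) (sym (cong proj₁ eq)) r′))
          in cong₂ _,_ (Y-≡ x≡) (Y-≡ y≡)

      label : ℕ → Y
      label n = to seed n , fromWitness (map₂ seed⊆R (graph-dom seed ℕ×ℕ↣ℕ n))

      label-injective : ∀ {k n} → label k ≡ label n → k ≡ n
      label-injective = inj seed ∘ cong proj₁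

      -- Distinct labels give embeddings of Y into itself with disjoint images.
      tagged : ℕ → Y → Y
      tagged n y = to pairing (label n , y)

      tagged-injective : ∀ {k n y y′} → tagged k y ≡ tagged n y′ → k ≡ n × y ≡ y′
      tagged-injective eq = let l≡ , y≡ = ,-injective (inj pairing eq) in label-injective l≡ , y≡

      square : Yᶜ ↣ Y → (X × X) ↣ X
      square i = mk↣ {to = λ (x , x′) → proj₁ (to pairing (f x em , f x′ em))} λ eq →
        let x≡ , y≡ = ,-injective (inj pairing (Y-≡ eq)) in
        cong₂ _,_ (f-injective em em x≡) (f-injective em em y≡)
        where
        f : ∀ x → Dec (Dom R x) → Y
        f x (yes x∈) = tagged 0 (x , fromWitness x∈)
        f x (no  x∉) = tagged 1 (to i (x , fromWitness x∉))

        f-injective : ∀ {x x′} d d′ → f x d ≡ f x′ d′ → x ≡ x′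
        f-injective (yes _) (yes _) eq = cong proj₁ (proj₂ (tagged-injective eq))
        f-injective (no _)  (no _)  eq = cong proj₁ (inj i (proj₂ (tagged-injective eq)))
        f-injective (yes _) (no _)  eq with () ← proj₁ (tagged-injective eq)
        f-injective (no _)  (yes _) eq with () ← proj₁ (tagged-injective eq)

      Y↣̸Yᶜ : ¬ (Y ↣ Yᶜ)
      -- The element `to j (label 0)` lies in the domain of the enlarged pairing, hence by
      -- maximality in that of R, although j takes values in the complement.
      Y↣̸Yᶜ j = toWitness (proj₂ (to j (label 0)))
        (domˡ (R-max (graph-isPairing e op) R⊆graph (proj₂ (graph-dom e op (label 0 , true)))))
        where
        W = Y × Bool

        e : W ↣ X
        e = mk↣ {to = e′} λ {p} {q} → e-injective p q
          where
          e′ : W → X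
          e′ (y , false) = proj₁ y
          e′ (y , true)  = proj₁ (to j y)

          disjoint : ∀ y y′ → proj₁ y ≢ proj₁ (to j y′)
          disjoint y y′ eq = toWitness (proj₂ (to j y′)) (subst (Dom R) eq (dom y))

          e-injective : ∀ p q → e′ p ≡ e′ q → p ≡ q
          e-injective (y , false) (y′ , false) eq = cong (_, false) (Y-≡ eq)
          e-injective (y , true)  (y′ , true)  eq = cong (_, true) (inj j (Yᶜ-≡ eq))
          e-injective (y , false) (y′ , true)  eq = contradiction eq (disjoint y y′)
          e-injective (y , true)  (y′ , false) eq = contradiction (sym eq) (disjoint y′ y)

        bit : Bool → ℕ
        bit false = 0
        bit true  = 1

        bit-injective : ∀ {s t} → bit s ≡ bit t → s ≡ t
        bit-injective {false} {false} _ = refl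
        bit-injective {true}  {true}  _ = refl

        -- ℕ×ℕ↣ℕ sends (0 , 0) to 0, so op below extends the pairing of Y.
        mark : ℕ → Y → W
        mark zero    y = y , false
        mark (suc k) y = tagged k y , true

        mark-injective : ∀ k n {y y′} → mark k y ≡ mark n y′ → k ≡ n × y ≡ y′
        mark-injective zero    zero    eq = refl , cong proj₁ eq
        mark-injective (suc k) (suc n) eq =
          let k≡n , y≡y′ = tagged-injective (cong proj₁ eq) in cong suc k≡n , y≡y′
        mark-injective zero    (suc n) eq with () ← cong proj₂ eq
        mark-injective (suc k) zero    eq with () ← cong proj₂ eq

        op : (W × W) ↣ W
        op = mk↣
          {to = λ ((y , s) , (y′ , s′)) → mark (to ℕ×ℕ↣ℕ (bit s , bit s′)) (to pairing (y , y′))}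
          λ {((y , s) , (y′ , s′))} {((x , t) , (x′ , t′))} eq →
          let k≡ , z≡ = mark-injective (to ℕ×ℕ↣ℕ (bit s , bit s′)) (to ℕ×ℕ↣ℕ (bit t , bit t′)) eq
              s≡ , s′≡ = ,-injective (inj ℕ×ℕ↣ℕ k≡)
              y≡ , y′≡ = ,-injective (inj pairing z≡)
          in cong₂ _,_ (cong₂ _,_ y≡ (bit-injective s≡)) (cong₂ _,_ y′≡ (bit-injective s′≡))

        R⊆graph : R ⊆ graph e op
        R⊆graph {x , y , z} r = compr⁺ (Graph e op)
          (((x , fromWitness (domˡ r)) , false) , ((y , fromWitness (domʳ r)) , false) ,
           refl , refl , functional r (proj₂ (total (dom (x , fromWitness (domˡ r)))
                                                     (dom (y , fromWitness (domʳ r))))))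

-- Equivalences and renaming of variables

⇒-⇔ : ∀ {A B C D : Set a} → A ⇔ B → C ⇔ D → (A → C) ⇔ (B → D)
⇒-⇔ f g = mk⇔ (λ h → to g ∘ h ∘ from f) (λ h → from g ∘ h ∘ to f)
  where open Equivalence

Π-⇔ : ∀ {A : Set a} {P Q : A → Set b} → (∀ x → P x ⇔ Q x) → (∀ x → P x) ⇔ (∀ x → Q x)
Π-⇔ f = mk⇔ (λ h x → Equivalence.to (f x) (h x)) (λ h x → Equivalence.from (f x) (h x))

∃-⇔ : ∀ {A : Set a} {P : A → Set b} {Q : A → Set p} → (∀ x → P x ⇔ Q x) → ∃ P ⇔ ∃ Q
∃-⇔ f = mk⇔ (map₂ (Equivalence.to (f _))) (map₂ (Equivalence.from (f _)))

module _ {L : Language l} where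

  mutual
    renameᵗ : (Fin n → Fin k) → Term L n → Term L k
    renameᵗ ρ (var i)    = var (ρ i)
    renameᵗ ρ (app f ts) = app f (renameᵗˢ ρ ts)

    renameᵗˢ : (Fin n → Fin k) → Vec (Term L n) r → Vec (Term L k) r
    renameᵗˢ ρ []       = []
    renameᵗˢ ρ (t ∷ ts) = renameᵗ ρ t ∷ renameᵗˢ ρ ts

  rename : (Fin n → Fin k) → Formula L n → Formula L k
  rename ρ ⊥ᶠ         = ⊥ᶠ
  rename ρ (s ≈ᶠ t)   = renameᵗ ρ s ≈ᶠ renameᵗ ρ t
  rename ρ (rel R ts) = rel R (renameᵗˢ ρ ts)
  rename ρ (φ ∧ᶠ ψ)   = rename ρ φ ∧ᶠ rename ρ ψ
  rename ρ (φ ∨ᶠ ψ)   = rename ρ φ ∨ᶠ rename ρ ψ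
  rename ρ (φ ⇒ᶠ ψ)   = rename ρ φ ⇒ᶠ rename ρ ψ
  rename ρ (∀ᶠ φ)     = ∀ᶠ (rename (Fin.lift 1 ρ) φ)
  rename ρ (∃ᶠ φ)     = ∃ᶠ (rename (Fin.lift 1 ρ) φ)

  module _ (M : Structure L m) where

    Compatible : (Fin n → Fin k) → Vec (Carrier M) n → Vec (Carrier M) k → Set m
    Compatible ρ v w = ∀ i → lookup v i ≡ lookup w (ρ i)

    lift-compatible : ∀ {ρ : Fin n → Fin k} {v w} → Compatible ρ v w →
                      ∀ x → Compatible (Fin.lift 1 ρ) (x ∷ v) (x ∷ w)
    lift-compatible eq x zero    = refl
    lift-compatible eq x (suc i) = eq i

    mutual
      eval-rename : ∀ {ρ : Fin n → Fin k} {v w} → Compatible ρ v w → ∀ t →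
                    eval M v t ≡ eval M w (renameᵗ ρ t)
      eval-rename eq (var i)    = eq i
      eval-rename eq (app f ts) = cong (Structure.⟦_⟧ᶠ M f) (evals-rename eq ts)

      evals-rename : ∀ {ρ : Fin n → Fin k} {v w} → Compatible ρ v w → ∀ (ts : Vec (Term L n) r) →
                     evals M v ts ≡ evals M w (renameᵗˢ ρ ts)
      evals-rename eq []       = refl
      evals-rename eq (t ∷ ts) = cong₂ _∷_ (eval-rename eq t) (evals-rename eq ts)

    Sat-rename : ∀ {ρ : Fin n → Fin k} {v w} → Compatible ρ v w → ∀ φ →
                 Sat M φ v ⇔ Sat M (rename ρ φ) w
    Sat-rename eq ⊥ᶠ         = ⇔-id _
    Sat-rename {ρ = ρ} {v} {w} eq (s ≈ᶠ t)
      rewrite eval-rename {ρ = ρ} {v} {w} eq s | eval-rename {ρ = ρ} {v} {w} eq t = ⇔-id _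
    Sat-rename {ρ = ρ} {v} {w} eq (rel R ts)
      rewrite evals-rename {ρ = ρ} {v} {w} eq ts = ⇔-id _
    Sat-rename eq (φ ∧ᶠ ψ)   = Sat-rename eq φ ×-⇔ Sat-rename eq ψ
    Sat-rename eq (φ ∨ᶠ ψ)   = Sat-rename eq φ ⊎-⇔ Sat-rename eq ψ
    Sat-rename eq (φ ⇒ᶠ ψ)   = ⇒-⇔ (Sat-rename eq φ) (Sat-rename eq ψ)
    Sat-rename eq (∀ᶠ φ)     = Π-⇔ λ x → Sat-rename (lift-compatible eq x) φ
    Sat-rename eq (∃ᶠ φ)     = ∃-⇔ λ x → Sat-rename (lift-compatible eq x) φ

-- Boundary points and ranks

module Order {C : Set m} (_<_ : C → C → Set m) where

  Between : C → C → C → Set m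
  Between x y z = ¬ (z < x) × ¬ (y < z)

  LocallyConstant : (C → Set m) → C → Set m
  LocallyConstant S x = ∃[ u ] ∃[ v ] u < x × x < v ×
    (∀ z → u < z → z < v → (S z → S x) × (S x → S z))

  -- The topological boundary of S for the order topology, in first-order form. It depends on S
  -- alone and not on a decomposition into pieces.
  Boundary : (C → Set m) → C → Set m
  Boundary S x = ¬ LocallyConstant S x

  -- For finite F: exactly j elements of F lie below x.
  Rank : (C → Set m) → ℕ → C → Set m
  Rank F zero    x = ∀ y → F y → ¬ (y < x)
  Rank F (suc j) x = ∃[ y ] F y × y < x × (∀ z → F z → y < z → ¬ (z < x)) × Rank F j y

-- Definability over fixed parameters

-- Free variables are grouped into blocks, so that substitutions can be written as
-- maps between nested pairs instead of renamings of one long tuple.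
data Shape : Set where
  one : Shape
  vec : ℕ → Shape
  _⊗_ : Shape → Shape → Shape

infixr 4 _⊗_

size : Shape → ℕ
size one     = 1
size (vec k) = k
size (s ⊗ t) = size s + size t

module Definability {L : Language l} (lt : Rel L 2) (M : Structure L m)
  {q : ℕ} (d : Vec (Carrier M) q)
  where

  private
    variable
      s t t′ : Shape

  infix 4 _<_
  _<_ : Carrier M → Carrier M → Set m
  x < y = Structure.⟦_⟧ʳ M lt (x ∷ y ∷ [])

  Env : Shape → Set m
  Env one     = Carrier M
  Env (vec k) = Vec (Carrier M) k
  Env (s ⊗ t) = Env s × Env t

  flatten : ∀ s → Env s → Vec (Carrier M) (size s)
  flatten one     x       = x ∷ []
  flatten (vec k) v       = v
  flatten (s ⊗ t) (γ , δ) = flatten s γ ++ flatten t δ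

  -- The maps of environments that only copy and rearrange entries; exactly these act on formulas by
  -- renaming, so index arithmetic is confined to their combinators.
  record Selection (s t : Shape) (σ : Env s → Env t) : Set m where
    constructor selection
    field
      index      : Fin (size t) → Fin (size s)
      compatible : ∀ γ → Compatible M index (flatten t (σ γ)) (flatten s γ)

  all : Selection s s id
  all = selection id λ γ i → refl

  fst : ∀ {σ} → Selection s (t ⊗ t′) σ → Selection s t (proj₁ ∘ σ)
  fst {t = t} {t′} (selection ρ eq) = selection (ρ ∘ (_↑ˡ size t′)) λ γ i →
    trans (sym (lookup-++ˡ (flatten t _) _ i)) (eq γ (i ↑ˡ size t′))

  snd : ∀ {σ} → Selection s (t ⊗ t′) σ → Selection s t′ (proj₂ ∘ σ)
  snd {t = t} {t′} (selection ρ eq) = selection (ρ ∘ (size t ↑ʳ_)) λ γ i →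
    trans (sym (lookup-++ʳ (flatten t _) _ i)) (eq γ (size t ↑ʳ i))

  infixr 4 _&_
  _&_ : ∀ {σ τ} → Selection s t σ → Selection s t′ τ → Selection s (t ⊗ t′) (λ γ → σ γ , τ γ)
  _&_ {s = s} {t} {t′} {σ} {τ} (selection ρ eq) (selection ρ′ eq′) =
    selection ([ ρ , ρ′ ]′ ∘ splitAt (size t)) λ γ i →
      trans (lookup-splitAt (size t) (flatten t (σ γ)) (flatten t′ (τ γ)) i) (choose γ (splitAt (size t) i))
    where
    choose : ∀ γ z → [ lookup (flatten t (σ γ)) , lookup (flatten t′ (τ γ)) ]′ z ≡
                     lookup (flatten s γ) ([ ρ , ρ′ ]′ z)
    choose γ (inj₁ i) = eq γ i
    choose γ (inj₂ i) = eq′ γ i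

  cons : ∀ {σ τ} → Selection s one σ → Selection s (vec k) τ →
         Selection s (vec (suc k)) (λ γ → σ γ ∷ τ γ)
  cons σ τ = let selection ρ eq = σ & τ in selection ρ eq

  record Def (s : Shape) (S : Env s → Set m) : Set (l ⊔ m) where
    constructor def
    field
      formula : Formula L (size s + q)
      correct : ∀ γ → S γ ⇔ Sat M formula (flatten s γ ++ d)

  Def-cong : {S S′ : Env s → Set m} → (∀ γ → S′ γ ⇔ S γ) → Def s S → Def s S′
  Def-cong eq (def φ c) = def φ λ γ → c γ ⇔-∘ eq γ

  Def-subst : {S : Env t → Set m} {σ : Env s → Env t} → Selection s t σ → Def t S → Def s (S ∘ σ)
  Def-subst {t = t} {s = s} {σ = σ} sel (def φ c) = def (rename index′ φ) λ γ →
    Sat-rename M {ρ = index′} {w = flatten s γ ++ d} (compatible′ γ) φ ⇔-∘ c (σ γ)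
    where
    open Selection sel

    index′ : Fin (size t + q) → Fin (size s + q)
    index′ = [ (_↑ˡ q) ∘ index , size s ↑ʳ_ ]′ ∘ splitAt (size t)

    compatible′ : ∀ γ → Compatible M index′ (flatten t (σ γ) ++ d) (flatten s γ ++ d)
    compatible′ γ i = trans (lookup-splitAt (size t) (flatten t (σ γ)) d i) (choose (splitAt (size t) i))
      where
      choose : ∀ z → [ lookup (flatten t (σ γ)) , lookup d ]′ z ≡
                     lookup (flatten s γ ++ d) ([ (_↑ˡ q) ∘ index , size s ↑ʳ_ ]′ z)
      choose (inj₁ i) = trans (compatible γ i) (sym (lookup-++ˡ (flatten s γ) d (index i)))
      choose (inj₂ i) = sym (lookup-++ʳ (flatten s γ) d i)

  Def-< : ∀ {σ τ} → Selection s one σ → Selection s one τ → Def s (λ γ → σ γ < τ γ)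
  Def-< σ τ = Def-subst (σ & τ) (def (rel lt (var zero ∷ var (suc zero) ∷ [])) λ _ → ⇔-id _)

  Def-× : {S S′ : Env s → Set m} → Def s S → Def s S′ → Def s (λ γ → S γ × S′ γ)
  Def-× (def φ c) (def φ′ c′) = def (φ ∧ᶠ φ′) λ γ → c γ ×-⇔ c′ γ

  Def-→ : {S S′ : Env s → Set m} → Def s S → Def s S′ → Def s (λ γ → S γ → S′ γ)
  Def-→ (def φ c) (def φ′ c′) = def (φ ⇒ᶠ φ′) λ γ → ⇒-⇔ (c γ) (c′ γ)

  Def-¬ : {S : Env s → Set m} → Def s S → Def s (λ γ → ¬ S γ)
  Def-¬ (def φ c) = def (φ ⇒ᶠ ⊥ᶠ) λ γ → mk⇔
    (λ ¬S s → ⊥-elim (¬S (Equivalence.from (c γ) s)))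
    (λ ¬S s → case ¬S (Equivalence.to (c γ) s) of λ ())

  Def-∀ : {S : Carrier M → Env s → Set m} → Def (one ⊗ s) (uncurry S) → Def s (λ γ → ∀ x → S x γ)
  Def-∀ (def φ c) = def (∀ᶠ φ) λ γ → Π-⇔ λ x → c (x , γ)

  Def-∃ : ∀ t {S : Env t → Env s → Set m} → Def (t ⊗ s) (uncurry S) → Def s (λ γ → ∃ λ δ → S δ γ)
  Def-∃ one           (def φ c) = def (∃ᶠ φ) λ γ → ∃-⇔ λ x → c (x , γ)
  Def-∃ (vec zero)    (def φ c) = def φ λ γ → c ([] , γ) ⇔-∘ mk⇔ (λ where ([] , s) → s) ([] ,_)
  Def-∃ (vec (suc k)) D = Def-cong
    (λ γ → mk⇔ (λ where (x ∷ v , s) → v , x , s) (λ (v , x , s) → x ∷ v , s))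
    (Def-∃ (vec k) (Def-∃ one (Def-subst (cons (fst all) (fst (snd all)) & snd (snd all)) D)))
  Def-∃ (t ⊗ t′) D = Def-cong
    (λ γ → mk⇔ (λ ((x , y) , s) → y , x , s) (λ (y , x , s) → (x , y) , s))
    (Def-∃ t′ (Def-∃ t (Def-subst ((fst all & fst (snd all)) & snd (snd all)) D)))

  open Order _<_ public

  Def-Boundary : {S : Carrier M → Env s → Set m} → Def (one ⊗ s) (uncurry S) →
                 Def (one ⊗ s) (λ (x , γ) → Boundary (λ z → S z γ) x)
  -- The most recently bound variable stands first, so the innermost environment is
  -- `(z , hi , lo , x , γ)`.
  Def-Boundary D = Def-¬ (Def-∃ one (Def-∃ one
    (Def-× (Def-< lo x) (Def-× (Def-< x hi) (Def-∀ (Def-→ (Def-< (fst (snd (snd all))) (fst all))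
      (Def-→ (Def-< (fst all) (fst (snd all)))
        (Def-× (Def-→ Sz Sx) (Def-→ Sx Sz)))))))))
    where
    x  = fst (snd (snd all))
    lo = fst (snd all)
    hi = fst all
    Sz = Def-subst (fst all & snd (snd (snd (snd all)))) D
    Sx = Def-subst (snd (snd (snd all))) D

  Def-Rank : {F : Carrier M → Env s → Set m} → Def (one ⊗ s) (uncurry F) → ∀ j →
             Def (one ⊗ s) (λ (x , γ) → Rank (λ z → F z γ) j x)
  Def-Rank D zero    = Def-∀ (Def-→ (Def-subst (fst all & snd (snd all)) D)
                                    (Def-¬ (Def-< (fst all) (fst (snd all)))))
  Def-Rank D (suc j) = Def-∃ one (Def-× Fy (Def-× (Def-< y x) (Def-×
    (Def-∀ (Def-→ Fz (Def-→ (Def-< (fst (snd all)) (fst all))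
                           (Def-¬ (Def-< (fst all) (fst (snd (snd all))))))))
    (Def-subst (y & snd (snd all)) (Def-Rank D j)))))
    where
    y = fst all
    x = fst (snd all)
    Fy = Def-subst (fst all & snd (snd all)) D
    Fz = Def-subst (fst all & snd (snd (snd all))) D

-- Finite unions of points and intervals

module Geometry (em : ∀ {ℓ} → ExcludedMiddle ℓ) {C : Set m} (_<_ : C → C → Set m)
  (isDLO : IsDenseLinearOrder _≡_ _<_)
  (no-least : ∀ x → ∃[ y ] y < x) (no-greatest : ∀ x → ∃[ y ] x < y)
  where

  open Order _<_
  open import Relation.Binary.Construct.Add.Extrema.Strict _<_ using (_<±_)
  open IsDenseLinearOrder isDLO using (compare; dense; irrefl; asym) renaming (trans to <-trans)

  irr : ∀ {x} → ¬ (x < x)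
  irr = irrefl refl

  ≮-<-trans : ∀ {x y z} → ¬ (y < x) → y < z → x < z
  ≮-<-trans {x} {y} y≮x y<z with compare x y
  ... | tri< x<y _ _  = <-trans x<y y<z
  ... | tri≈ _ refl _ = y<z
  ... | tri> _ _ y<x  = contradiction y<x y≮x

  <-≮-trans : ∀ {x y z} → x < y → ¬ (z < y) → x < z
  <-≮-trans {x} {y} {z} x<y z≮y with compare y z
  ... | tri< y<z _ _  = <-trans x<y y<z
  ... | tri≈ _ refl _ = x<y
  ... | tri> _ _ z<y  = contradiction z<y z≮y

  between-< : ∀ {x y} u → u < y → x < y → ∃[ z ] u < z × x < z × z < y
  between-< {x} u u<y x<y with compare u x
  ... | tri< u<x _ _  = let z , x<z , z<y = dense x<y in z , <-trans u<x x<z , x<z , z<y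
  ... | tri≈ _ refl _ = let z , x<z , z<y = dense x<y in z , x<z , x<z , z<y
  ... | tri> _ _ x<u  = let z , u<z , z<y = dense u<y in z , u<z , <-trans x<u u<z , z<y

  between-> : ∀ {x y} v → y < v → y < x → ∃[ z ] z < v × z < x × y < z
  between-> {x} v y<v y<x with compare v x
  ... | tri< v<x _ _  = let z , y<z , z<v = dense y<v in z , z<v , <-trans z<v v<x , y<z
  ... | tri≈ _ refl _ = let z , y<z , z<v = dense y<v in z , z<v , z<v , y<z
  ... | tri> _ _ x<v  = let z , y<z , z<x = dense y<x in z , <-trans z<x x<v , z<x , y<z

  -- An interval around x exists because there are no endpoints; density shrinks it once for each
  -- element of the list that has to be excluded.
  isolate : ∀ vs {x} → x ∉ vs →
            ∃[ u ] ∃[ w ] u < x × x < w × (∀ {v} → v ∈ vs → u < v → ¬ (v < w))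
  isolate []       {x} _ = let u , u<x = no-least x ; w , x<w = no-greatest x in u , w , u<x , x<w , λ ()
  isolate (v ∷ vs) {x} x∉ with isolate vs (x∉ ∘ there) | compare v x
  ... | _ | tri≈ _ refl _ = contradiction (here refl) x∉
  ... | u , w , u<x , x<w , free | tri< v<x _ _ =
        let u′ , u<u′ , v<u′ , u′<x = between-< u u<x v<x in
        u′ , w , u′<x , x<w , λ where
          (here refl) u′<v → contradiction (<-trans u′<v v<u′) irr
          (there v∈)  u′<v → free v∈ (<-trans u<u′ u′<v)
  ... | u , w , u<x , x<w , free | tri> _ _ x<v =
        let w′ , w′<w , w′<v , x<w′ = between-> w x<w x<v in
        u , w′ , u<x , x<w′ , λ where
          (here refl) u<v v<w′ → irr (<-trans v<w′ w′<v)
          (there v∈)  u<v v<w′ → free v∈ u<v (<-trans v<w′ w′<w)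

  finite-ends : C ± → List C
  finite-ends [ x ] = x ∷ []
  finite-ends _     = []

  endpoints : Piece _<_ → List C
  endpoints (point x)          = x ∷ []
  endpoints (interval lo hi _) = finite-ends lo List.++ finite-ends hi

  Avoids : C → C → List C → Set m
  Avoids x y vs = ∀ {v} → v ∈ vs → ¬ Between x y v

  below-lo : ∀ lo {x y} → x < y → Avoids x y (finite-ends lo) →
             (lo <± [ x ] → lo <± [ y ]) × (lo <± [ y ] → lo <± [ x ])
  below-lo ⊥±     x<y av = (λ _ → ⊥±<[ _ ]) , (λ _ → ⊥±<[ _ ])
  below-lo ⊤±     x<y av = (λ ()) , (λ ())
  below-lo [ v ]  x<y av =
    (λ where ([ v<x ]) → [ <-trans v<x x<y ]) ,
    (λ where ([ v<y ]) → [ decidable-stable em (λ v≮x → av (here refl) (v≮x , asym v<y)) ])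

  above-hi : ∀ hi {x y} → x < y → Avoids x y (finite-ends hi) →
             ([ x ] <± hi → [ y ] <± hi) × ([ y ] <± hi → [ x ] <± hi)
  above-hi ⊥±     x<y av = (λ where (⁺.[ () ])) , (λ where (⁺.[ () ]))
  above-hi ⊤±     x<y av = (λ _ → [ _ ]<⊤±) , (λ _ → [ _ ]<⊤±)
  above-hi [ v ]  x<y av =
    (λ where ([ x<v ]) → [ decidable-stable em (λ y≮v → av (here refl) (asym x<v , y≮v)) ]) ,
    (λ where ([ y<v ]) → [ <-trans x<y y<v ])

  Avoids-++ : ∀ us {vs x y} → Avoids x y (us List.++ vs) → Avoids x y us × Avoids x y vs
  Avoids-++ us av = av ∘ ∈-++⁺ˡ , av ∘ ∈-++⁺ʳ us

  piece-constant : ∀ π {x y} → x < y → Avoids x y (endpoints π) →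
                   (⟦_⟧ᵖ _<_ π x → ⟦_⟧ᵖ _<_ π y) × (⟦_⟧ᵖ _<_ π y → ⟦_⟧ᵖ _<_ π x)
  piece-constant (point v) x<y av =
    (λ where refl → contradiction (irr , asym x<y) (av (here refl))) ,
    (λ where refl → contradiction (asym x<y , irr) (av (here refl)))
  piece-constant (interval lo hi _) x<y av =
    let avˡ , avʳ = Avoids-++ (finite-ends lo) av
        lo⁺ , lo⁻ = below-lo lo x<y avˡ
        hi⁺ , hi⁻ = above-hi hi x<y avʳ
    in (λ (p , q) → lo⁺ p , hi⁺ q) , (λ (p , q) → lo⁻ p , hi⁻ q)

  pieces-constant : ∀ πs {x y} → x < y → Avoids x y (concatMap endpoints πs) →
                    (Any (λ π → ⟦_⟧ᵖ _<_ π x) πs → Any (λ π → ⟦_⟧ᵖ _<_ π y) πs) ×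
                    (Any (λ π → ⟦_⟧ᵖ _<_ π y) πs → Any (λ π → ⟦_⟧ᵖ _<_ π x) πs)
  pieces-constant []       x<y av = (λ ()) , (λ ())
  pieces-constant (π ∷ πs) x<y av =
    let avˡ , avʳ = Avoids-++ (endpoints π) av
        p⁺ , p⁻ = piece-constant π x<y avˡ
        q⁺ , q⁻ = pieces-constant πs x<y avʳ
    in (λ where (here p)  → here (p⁺ p)
                (there q) → there (q⁺ q)) ,
       (λ where (here p)  → here (p⁻ p)
                (there q) → there (q⁻ q))

  Agrees : (C → Set m) → C → C → Set m
  Agrees S x y = (S x → S y) × (S y → S x)

  iff-trans : {P Q R : Set m} → (P → Q) × (Q → P) → (Q → R) × (R → Q) → (P → R) × (R → P)
  iff-trans (f , g) (f′ , g′) = f′ ∘ f , g ∘ g′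

  module Tame {S : C → Set m} (finite-union : IsFiniteUnion _<_ S) where

    -- A finite superset of the boundary, since abutting pieces may leave S constant around an
    -- endpoint. Finiteness comes from this list, definability from `Boundary`.
    breaks : List C
    breaks = concatMap endpoints (proj₁ finite-union)

    constant : ∀ {x y} → x < y → Avoids x y breaks → Agrees S x y
    constant x<y av =
      let πs , S⊆ , ⊆S = finite-union ; f , g = pieces-constant πs x<y av
      in ⊆S ∘ f ∘ S⊆ , ⊆S ∘ g ∘ S⊆

    Boundary⊆breaks : ∀ {x} → Boundary S x → x ∈ breaks
    Boundary⊆breaks {x} bd = decidable-stable em λ x∉ →
      let u , w , u<x , x<w , free = isolate breaks x∉ in
      bd (u , w , u<x , x<w , λ z u<z z<w → case compare z x of λ where
        (tri< z<x _ _) → constant z<x λ v∈ (v≮z , x≮v) →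
                           free v∈ (<-≮-trans u<z v≮z) (≮-<-trans x≮v x<w)
        (tri≈ _ refl _) → id , id
        (tri> _ _ x<z) → swap (constant x<z λ v∈ (v≮x , z≮v) →
                           free v∈ (<-≮-trans u<x v≮x) (≮-<-trans z≮v z<w)))

    -- Connectedness of intervals, by induction on the breaks inside [x, y].
    no-boundary⇒constant : ∀ {x y} → x < y → (∀ {z} → Between x y z → ¬ Boundary S z) → Agrees S x y
    no-boundary⇒constant {x} {y} x<y no-bd = go breaks x<y no-bd (λ v∈ _ → v∈)
      where
      go : ∀ vs {x y} → x < y → (∀ {z} → Between x y z → ¬ Boundary S z) →
           (∀ {v} → v ∈ breaks → Between x y v → v ∈ vs) → Agrees S x y
      go [] x<y no-bd cover = constant x<y λ v∈ btw → case cover v∈ btw of λ ()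
      go (v ∷ vs) {x} {y} x<y no-bd cover with em {P = Between x y v}
      ... | no ¬btw = go vs x<y no-bd λ z∈ btw → case cover z∈ btw of λ where
              (here refl) → contradiction btw ¬btw
              (there z∈)  → z∈
      -- A break v that is not a boundary point has a neighbourhood on which S is constant. It
      -- bridges the gap around v, and the two remaining intervals avoid v, so v drops out of the
      -- list.
      ... | yes (v≮x , y≮v) with decidable-stable em (no-bd (v≮x , y≮v))
      ...   | u , w , u<v , v<w , const-near = iff-trans left right
        where
        left : Agrees S x v
        left with compare x v
        ... | tri≈ _ refl _ = id , id
        ... | tri> _ _ v<x  = contradiction v<x v≮x
        ... | tri< x<v _ _ =
          let z , u<z , x<z , z<v = between-< u u<v x<v in
          iff-trans
            (go vs x<z (λ (t≮x , z≮t) → no-bd (t≮x , asym (<-≮-trans (≮-<-trans z≮t z<v) y≮v)))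
              λ t∈ (t≮x , z≮t) → case cover t∈ (t≮x , asym (<-≮-trans (≮-<-trans z≮t z<v) y≮v)) of λ where
                (here refl) → contradiction z<v z≮t
                (there t∈)  → t∈)
            (const-near z u<z (<-trans z<v v<w))

        right : Agrees S v y
        right with compare v y
        ... | tri≈ _ refl _ = id , id
        ... | tri> _ _ y<v  = contradiction y<v y≮v
        ... | tri< v<y _ _ =
          let z , z<w , z<y , v<z = between-> w v<w v<y in
          iff-trans
            (swap (const-near z (<-trans u<v v<z) z<w))
            (go vs z<y (λ (t≮z , y≮t) → no-bd (asym (≮-<-trans v≮x (<-≮-trans v<z t≮z)) , y≮t))
              λ t∈ (t≮z , y≮t) → case cover t∈ (asym (≮-<-trans v≮x (<-≮-trans v<z t≮z)) , y≮t) of λ where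
                (here refl) → contradiction v<z t≮z
                (there t∈)  → t∈)

  largest : (Q : C → Set m) → ∀ vs →
            (∀ {v} → v ∈ vs → ¬ Q v) ⊎ ∃[ x ] Q x × x ∈ vs × (∀ {v} → v ∈ vs → Q v → ¬ (x < v))
  largest Q []       = inj₁ λ ()
  largest Q (v ∷ vs) with largest Q vs | em {P = Q v}
  ... | inj₁ none | no ¬q = inj₁ λ where
          (here refl) → ¬q
          (there v∈)  → none v∈
  ... | inj₁ none | yes q = inj₂ (v , q , here refl , λ where
          (here refl) _ → irr
          (there v∈)  p → contradiction p (none v∈))
  ... | inj₂ (x , qx , x∈ , ub) | no ¬q = inj₂ (x , qx , there x∈ , λ where
          (here refl) p → contradiction p ¬q
          (there v∈)    → ub v∈)
  ... | inj₂ (x , qx , x∈ , ub) | yes q with compare x v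
  ...   | tri< x<v _ _ = inj₂ (v , q , here refl , λ where
          (here refl) _     → irr
          (there t∈)  p v<t → ub t∈ p (<-trans x<v v<t))
  ...   | tri≈ x≮v _ _ = inj₂ (x , qx , there x∈ , λ where
          (here refl) _ → x≮v
          (there t∈)    → ub t∈)
  ...   | tri> x≮v _ _ = inj₂ (x , qx , there x∈ , λ where
          (here refl) _ → x≮v
          (there t∈)    → ub t∈)

  -- Descends to the greatest element y of F below x and keeps only the candidates below y; y itself
  -- is discarded, so the list gets shorter.
  rank-exists : ∀ {F : C → Set m} vs x → (∀ {y} → F y → y < x → y ∈ vs) → ∃[ j ] Rank F j x
  rank-exists {F} vs x cover = go (length vs) vs x ℕ.≤-refl cover
    where
    go : ∀ n vs x → length vs ℕ.≤ n → (∀ {y} → F y → y < x → y ∈ vs) → ∃[ j ] Rank F j x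
    go n vs x len cover with largest (λ y → F y × y < x) vs
    ... | inj₁ none = zero , λ y Fy y<x → none (cover Fy y<x) (Fy , y<x)
    go zero    [] x len cover | inj₂ (_ , _ , () , _)
    go (suc n) vs x len cover | inj₂ (y , (Fy , y<x) , y∈ , ub) =
      let smaller = filter (λ v → em {P = v < y}) vs
          shrinks = filter-notAll (λ v → em {P = v < y}) vs (Any.map (λ where refl → irr) y∈)
          j , r = go n smaller y (ℕ.≤-pred (ℕ.<-≤-trans shrinks len))
                    (λ Fz z<y → ∈-filter⁺ (λ v → em {P = v < y}) (cover Fz (<-trans z<y y<x)) z<y)
      in suc j , y , Fy , y<x , (λ z Fz y<z z<x → ub (cover Fz z<x) (Fz , z<x) y<z) , r

  -- The greatest elements u and v of F below x and y again have equal rank. If one were below the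
  -- other, induction would place it below itself; so they coincide, and z, being at most u, is
  -- below x.
  rank-separates : ∀ {F : C → Set m} j {x y} → Rank F j x → Rank F j y → ∀ {z} → F z → z < y → z < x
  rank-separates zero rx ry Fz z<y = contradiction z<y (ry _ Fz)
  rank-separates (suc j) (u , Fu , u<x , _ , ru) (v , Fv , v<y , top , rv) {z} Fz z<y with compare u v
  ... | tri< u<v _ _ = contradiction (rank-separates j ru rv Fu u<v) irr
  ... | tri> _ _ v<u = contradiction (rank-separates j rv ru Fv v<u) irr
  ... | tri≈ _ refl _ = ≮-<-trans (λ u<z → top z Fz u<z z<y) u<x

-- The induction on the number of parameters

module Counting (em : ∀ {ℓ} → ExcludedMiddle ℓ) {L : Language l} (lt : Rel L 2) (M : Structure L m)
  (omin : IsOMinimal lt M) {q : ℕ} (d : Vec (Carrier M) q)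
  {X : Set m} (seed : ℕ ↣ X) (square : (X × X) ↣ X)
  where

  open Definability lt M d
  open IsOMinimal omin using (isDenseLinearOrder; no-least; no-greatest; tame)
  open IsDenseLinearOrder isDenseLinearOrder using (compare)
  open Geometry em _<_ isDenseLinearOrder no-least no-greatest
  open Injection using (to; injective)

  Def⇒finite-union : ∀ {s} {S : Carrier M → Env s → Set m} → Def (one ⊗ s) (uncurry S) →
                     ∀ γ → IsFiniteUnion _<_ (λ x → S x γ)
  Def⇒finite-union {s} {S} (def φ c) γ = tame (λ x → S x γ)
    (_ , φ , flatten s γ ++ d ,
     (λ { {x ∷ []} → Equivalence.to (c (x , γ)) }) ,
     (λ { {x ∷ []} → Equivalence.from (c (x , γ)) }))

  rank-injective : ∀ {F : Carrier M → Set m} j {x y} → F x → F y → Rank F j x → Rank F j y → x ≡ y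
  rank-injective j {x} {y} Fx Fy rx ry with compare x y
  ... | tri< x<y _ _ = contradiction (rank-separates j rx ry Fx x<y) irr
  ... | tri≈ _ x≡y _ = x≡y
  ... | tri> _ _ y<x = contradiction (rank-separates j ry rx Fy y<x) irr

  code : ℕ → ℕ → X → X → X
  code i j x y = to square (to square (to seed i , to seed j) , to square (x , y))

  code-injective : ∀ {i j x y i′ j′ x′ y′} → code i j x y ≡ code i′ j′ x′ y′ →
                   (i ≡ i′ × j ≡ j′) × (x ≡ x′ × y ≡ y′)
  code-injective eq =
    let eq₁ , eq₂ = ,-injective (injective square eq)
        i≡ , j≡ = ,-injective (injective square eq₁)
    in (injective seed i≡ , injective seed j≡) , ,-injective (injective square eq₂)

  -- At most |X| traces on A.  The map g only has to separate different traces; it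
  -- is made to respect equality of traces once, at the end.
  Counted : ∀ (s : Shape) (A : Env s → Set m) k → (Env s → Vec (Carrier M) k → Set m) → Set m
  Counted s A k φ = Σ (Vec (Carrier M) k → X) λ g →
    ∀ {c c′} → g c ≡ g c′ → ∀ v → A v → φ v c → φ v c′

  module Step {k : ℕ} {s : Shape} {A : Env s → Set m} (DA : Def s A)
    {φ : Env s → Vec (Carrier M) (suc k) → Set m} (Dφ : Def (s ⊗ vec (suc k)) (uncurry φ))
    where

    fibre : Env s → Vec (Carrier M) k → Carrier M → Set m
    fibre a c x = φ a (x ∷ c)

    -- Break c is the set E_c of the header, Corner c its boundary.
    Break : Vec (Carrier M) k → Carrier M → Set m
    Break c x = ∃[ a ] A a × Boundary (fibre a c) x

    Corner : Vec (Carrier M) k → Carrier M → Set m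
    Corner c = Boundary (Break c)

    -- The first index is 0 for x ∈ E_c; otherwise it is 1 or 2 as x is a
    -- boundary point of E_c or lies between two successive ones.
    Locates : ℕ → ℕ → Env s → Carrier M → Vec (Carrier M) k → Set m
    Locates 0             j w x c = Boundary (fibre w c) x × Rank (Boundary (fibre w c)) j x
    Locates 1             j w x c = Corner c x × Rank (Corner c) j x
    Locates (suc (suc _)) j w x c = (¬ Break c x × ¬ Corner c x) × Rank (Corner c) j x

    Def-fibre : Def (one ⊗ s ⊗ vec k) (λ (x , a , c) → fibre a c x)
    Def-fibre = Def-subst (fst (snd all) & cons (fst all) (snd (snd all))) Dφ

    Def-fibre-boundary : Def (one ⊗ s ⊗ vec k) (λ (x , a , c) → Boundary (fibre a c) x)
    Def-fibre-boundary = Def-Boundary Def-fibre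

    Def-Break : Def (one ⊗ vec k) (λ (x , c) → Break c x)
    Def-Break = Def-∃ s (Def-× (Def-subst (fst all) DA)
      (Def-subst (fst (snd all) & fst all & snd (snd all)) Def-fibre-boundary))

    Def-Corner : Def (one ⊗ vec k) (λ (x , c) → Corner c x)
    Def-Corner = Def-Boundary Def-Break

    Def-Locates : ∀ i j → Def (one ⊗ s ⊗ vec k) (λ (x , w , c) → Locates i j w x c)
    Def-Locates 0 j = Def-× Def-fibre-boundary (Def-Rank Def-fibre-boundary j)
    Def-Locates 1 j = Def-subst (fst all & snd (snd all)) (Def-× Def-Corner (Def-Rank Def-Corner j))
    Def-Locates (suc (suc _)) j = Def-subst (fst all & snd (snd all))
      (Def-× (Def-× (Def-¬ Def-Break) (Def-¬ Def-Corner)) (Def-Rank Def-Corner j))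

    module Fibre (a : Env s) (c : Vec (Carrier M) k) = Tame {S = fibre a c}
      (Def⇒finite-union {S = λ x (a , c) → fibre a c x} Def-fibre (a , c))

    module Breaks (c : Vec (Carrier M) k) = Tame {S = Break c}
      (Def⇒finite-union {S = λ x c → Break c x} Def-Break c)

    Location : Carrier M → Vec (Carrier M) k → Set m
    Location x c = ∃[ i ] ∃[ j ] ∃[ w ] A w × Locates i j w x c

    locate : ∃ A → ∀ x c → Location x c
    locate (a₀ , Aa₀) x c = go em em
      where
      corner-rank : ∃[ j ] Rank (Corner c) j x
      corner-rank = rank-exists {F = Corner c} (Breaks.breaks c) x (λ bd _ → Breaks.Boundary⊆breaks c bd)

      fibre-rank : ∀ w → ∃[ j ] Rank (Boundary (fibre w c)) j x
      fibre-rank w = rank-exists {F = Boundary (fibre w c)} (Fibre.breaks w c) x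
        (λ bd _ → Fibre.Boundary⊆breaks w c bd)

      go : Dec (Break c x) → Dec (Corner c x) → Location x c
      go (yes (w , Aw , bd)) _ = 0 , proj₁ (fibre-rank w) , w , Aw , bd , proj₂ (fibre-rank w)
      -- Corners depend on c alone, so the slot of w is filled by the default member `a₀`.
      go (no _)      (yes corner) = 1 , proj₁ corner-rank , a₀ , Aa₀ , corner , proj₂ corner-rank
      go (no ¬break) (no ¬corner) = 2 , proj₁ corner-rank , a₀ , Aa₀ , (¬break , ¬corner) , proj₂ corner-rank

    -- Connectedness is used twice. Equal ranks leave no corner in [x, y], so `Break c` is constant
    -- there and fails throughout, as it fails at x. Then no fibre over A has a boundary point in
    -- [x, y], so each is constant there.
    same-gap : ∀ j {x y c} → x < y → ¬ Break c x → ¬ Corner c y →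
               Rank (Corner c) j x → Rank (Corner c) j y →
               ∀ a → A a → Agrees (fibre a c) x y
    same-gap j {x} {y} {c} x<y ¬break ¬corner rx ry a Aa =
      Fibre.no-boundary⇒constant a c x<y λ btw bd → no-break btw (a , Aa , bd)
      where
      no-corner : ∀ {z} → Between x y z → ¬ Corner c z
      no-corner {z} (z≮x , y≮z) corner with compare z y
      ... | tri< z<y _ _  = z≮x (rank-separates j rx ry corner z<y)
      ... | tri≈ _ refl _ = ¬corner corner
      ... | tri> _ _ y<z  = y≮z y<z

      no-break : ∀ {z} → Between x y z → ¬ Break c z
      no-break {z} (z≮x , y≮z) break with compare x z
      ... | tri≈ _ refl _ = ¬break break
      ... | tri> _ _ z<x  = z≮x z<x
      ... | tri< x<z _ _  = ¬break (proj₂ (Breaks.no-boundary⇒constant c x<z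
              (λ (t≮x , z≮t) → no-corner (t≮x , λ y<t → y≮z (<-≮-trans y<t z≮t)))) break)

    Locates-same : ∀ i j {w x y c} → Locates i j w x c → Locates i j w y c →
                   ∀ a → A a → fibre a c x → fibre a c y
    Locates-same 0 j {c = c} (bx , rx) (by , ry) a _ = subst (fibre a c) (rank-injective j bx by rx ry)
    Locates-same 1 j {c = c} (bx , rx) (by , ry) a _ = subst (fibre a c) (rank-injective j bx by rx ry)
    Locates-same (suc (suc _)) j {x = x} {y} ((ebx , bx) , rx) ((eby , by) , ry) a Aa
      with compare x y
    ... | tri< x<y _ _  = proj₁ (same-gap j x<y ebx by rx ry a Aa)
    ... | tri≈ _ refl _ = id
    ... | tri> _ _ y<x  = proj₂ (same-gap j y<x eby bx ry rx a Aa)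

    -- For x located by w, the trace of (x , c) is {a : Transfer i j (a , w) c}.
    Transfer : ℕ → ℕ → Env (s ⊗ s) → Vec (Carrier M) k → Set m
    Transfer i j (a , w) c = ∃[ x ] Locates i j w x c × fibre a c x

    Def-Transfer : ∀ i j → Def ((s ⊗ s) ⊗ vec k) (uncurry (Transfer i j))
    Def-Transfer i j = Def-∃ one (Def-×
      (Def-subst (fst all & snd (fst (snd all)) & snd (snd all)) (Def-Locates i j))
      (Def-subst (fst all & fst (fst (snd all)) & snd (snd all)) Def-fibre))

    module _ (h : ∀ v → A v → X) (h-injective : ∀ {v w} Av Aw → h v Av ≡ h w Aw → v ≡ w) (a₀ : ∃ A)
      (IH : ∀ i j → Counted (s ⊗ s) (λ (a , w) → A a × A w) k (Transfer i j))
      where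

      counted : Counted s A (suc k) φ
      counted = g , λ { {x ∷ c} {x′ ∷ c′} eq v Av → go (locate a₀ x c) (locate a₀ x′ c′) eq v Av }
        where
        encode : ∀ {x} c → Location x c → X
        -- The induction hypothesis supplies a separate map for each i and j; storing both indices
        -- ensures that its values are compared only under the same map.
        encode c (i , j , w , Aw , _) = code i j (h w Aw) (proj₁ (IH i j) c)

        g : Vec (Carrier M) (suc k) → X
        g (x ∷ c) = encode c (locate a₀ x c)

        go : ∀ {x c x′ c′} (ℓ : Location x c) (ℓ′ : Location x′ c′) → encode c ℓ ≡ encode c′ ℓ′ →
             ∀ v → A v → fibre v c x → fibre v c′ x′
        go (i , j , w , Aw , loc) (_ , _ , _ , Aw′ , loc′) eq v Av φx with code-injective eq
        ... | (refl , refl) , (h≡ , g≡) with refl ← h-injective Aw Aw′ h≡ =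
          -- The point x witnesses `Transfer` at c, and equality of the inner codes yields a witness
          -- y at c′ with the same i, j and w. Since x′ has this location too, `Locates-same` passes
          -- from y to x′.
          let y , loc″ , φy = proj₂ (IH i j) g≡ (v , w) (Av , Aw) (_ , loc , φx)
          in Locates-same i j loc″ loc′ v Av φy

  -- Of the size of A only an injection h into X is retained. Thus X stays fixed while A is squared
  -- at each step, and `square` brings the product back into X.
  count : ∀ k {s : Shape} {A : Env s → Set m} → Def s A → (h : ∀ v → A v → X) →
          (∀ {v w} Av Aw → h v Av ≡ h w Aw → v ≡ w) → ∃ A →
          {φ : Env s → Vec (Carrier M) k → Set m} → Def (s ⊗ vec k) (uncurry φ) → Counted s A k φ
  -- The empty tuple is the only parameter, so a constant map separates all traces.
  count zero    DA h h-inj a₀ Dφ = const (to seed 0) , λ { {[]} {[]} _ v _ → id }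
  count (suc k) DA h h-inj a₀@(v₀ , Av₀) Dφ = Step.counted DA Dφ h h-inj a₀ λ i j →
    count k (Def-× (Def-subst (fst all) DA) (Def-subst (snd all) DA))
      (λ (v , w) (Av , Aw) → to square (h v Av , h w Aw))
      (λ (Av , Aw) (Av′ , Aw′) eq → let v≡ , w≡ = ,-injective (injective square eq) in
        cong₂ _,_ (h-inj Av Av′ v≡) (h-inj Aw Aw′ w≡))
      ((v₀ , v₀) , Av₀ , Av₀)
      (Step.Def-Transfer DA Dφ i j)

-- From a separating map to an injection on the quotient

module _ (em : ∀ {ℓ} → ExcludedMiddle ℓ) (ext : ∀ {a b} → Extensionality a b) where

  open Classical em ext

  module _ (S : Setoid a ℓ) {X : Set b} (x₀ : X) (g : Setoid.Carrier S → X)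
    (reflects : ∀ {x y} → g x ≡ g y → Setoid._≈_ S x y)
    where

    open Setoid S using (_≈_) renaming (Carrier to Y; sym to ≈-sym; trans to ≈-trans; refl to ≈-refl)

    class : Y → Subset Y
    class x = compr (x ≈_)

    value : (K : Subset Y) → Dec (∃[ x ] T (K x)) → X
    value K (yes (x , _)) = g x
    value K (no _)        = x₀

    -- g is evaluated at a representative chosen from the class. Equivalent elements have equal
    -- classes by extensionality of Boolean subsets, and `em` picks the same representative from
    -- equal classes.
    reflecting⇒Injection : Injection S (setoid X)
    reflecting⇒Injection = record
      { to        = λ x → value (class x) em
      ; cong      = λ {x} {y} x≈y → cong (λ K → value K em) (⊆-antisym {S = class x} {class y}
                      (λ {z} t → compr⁺ (y ≈_) {z} (≈-trans (≈-sym x≈y) (compr⁻ (x ≈_) {z} t)))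
                      (λ {z} t → compr⁺ (x ≈_) {z} (≈-trans x≈y (compr⁻ (y ≈_) {z} t))))
      ; injective = injective em em
      }
      where
      injective : ∀ {x y} d d′ → value (class x) d ≡ value (class y) d′ → x ≈ y
      injective {x} {y} (yes (z , t)) (yes (z′ , t′)) eq =
        ≈-trans (compr⁻ (x ≈_) {z} t) (≈-trans (reflects eq) (≈-sym (compr⁻ (y ≈_) {z′} t′)))
      injective {x} {y} (no ∉) _ _ = contradiction (x , compr⁺ (x ≈_) {x} ≈-refl) ∉
      injective {x} {y} _ (no ∉) _ = contradiction (y , compr⁺ (y ≈_) {y} ≈-refl) ∉

-- Application to the traces on A

module Conclusion (em : ∀ {ℓ} → ExcludedMiddle ℓ) (ext : ∀ {a b} → Extensionality a b)
  {L : Language l} (lt : Rel L 2) (M : Structure L m) (omin : IsOMinimal lt M)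
  {n k q : ℕ} (φ : Formula L (n + k)) (A : Pred (Vec (Carrier M) n) p)
  (χ : Formula L (n + q)) (d : Vec (Carrier M) q) (A≐χ : A ≐ λ v → Sat M χ (v ++ d))
  where

  open Classical em ext using (infinite⇒ℕ↣)
  open Definability lt M d

  -- Has the members of A, but lives at the level of the structure, where the counting takes place.
  χ-set : Env (vec n) → Set m
  χ-set v = Sat M χ (v ++ d)

  -- A with membership replaced by a proposition, so that X has the same
  -- cardinality as the setoid ⟪ A ⟫ but its equality is _≡_.
  X : Set m
  X = ∃[ v ] True (em {P = χ-set v})

  X-≡ : {x y : X} → proj₁ x ≡ proj₁ y → x ≡ y
  X-≡ {v , _} {.v , _} refl = cong {B = X} (v ,_) (T-irrelevant _ _)

  from-X : X → ∃ A
  from-X (v , t) = v , proj₂ A≐χ (toWitness t)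

  seed : Infinite ⟪ A ⟫ → ℕ ↣ X
  seed infinite = infinite⇒ℕ↣ λ (N , X↔N) → infinite (N , record
    { to        = λ (v , Av) → Inverse.to X↔N (v , fromWitness (proj₁ A≐χ Av))
    ; from      = from-X ∘ Inverse.from X↔N
    ; to-cong   = λ v≡w → cong (Inverse.to X↔N) (X-≡ v≡w)
    ; from-cong = λ where refl → refl
    ; inverse   = (λ v≡ → Inverse.inverseˡ X↔N (X-≡ v≡)) ,
                  (λ i≡ → cong proj₁ (Inverse.inverseʳ X↔N i≡))
    })

  Def-φ : Def (vec n ⊗ vec k) (λ (v , b) → Sat M φ (v ++ b))
  Def-φ = def (rename (_↑ˡ q) φ) λ (v , b) →
    Sat-rename M {ρ = _↑ˡ q} {v ++ b} {(v ++ b) ++ d} (λ i → sym (lookup-++ˡ (v ++ b) d i)) φ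

  module _ (seed : ℕ ↣ X) (square : (X × X) ↣ X) where

    open Counting em lt M omin d seed square

    counted : Counted (vec n) χ-set k (λ v b → Sat M φ (v ++ b))
    counted = count k (def χ λ v → ⇔-id _) (λ v Av → v , fromWitness Av) (λ _ _ → cong proj₁)
      (map₂ toWitness (Injection.to seed 0)) Def-φ

    traces↣X : Injection (Traces M φ A) (setoid X)
    traces↣X = reflecting⇒Injection em ext (Traces M φ A) (Injection.to seed 0) (proj₁ counted) λ eq →
      (λ {v} (Av , φv) → Av , proj₂ counted eq v (proj₁ A≐χ Av) φv) ,
      (λ {v} (Av , φv) → Av , proj₂ counted (sym eq) v (proj₁ A≐χ Av) φv)

    traces↣A : Injection (Traces M φ A) ⟪ A ⟫
    traces↣A = record
      { to        = from-X ∘ Injection.to traces↣X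
      ; cong      = cong proj₁ ∘ Injection.cong traces↣X
      ; injective = Injection.injective traces↣X ∘ X-≡
      }

proposition1 : (∀ {ℓ} → ExcludedMiddle ℓ) →
    (∀ {a b} → Extensionality a b) →
    ∀ {l m p : Level} (L : Language l) (lt : Rel L 2) (M : Structure L m) →
    IsOMinimal lt M →
    ∀ {n k : ℕ} (φ : Formula L (n + k)) (A : Pred (Vec (Carrier M) n) p) →
    Definable M A →
    Infinite ⟪ A ⟫ →
    Injection (Traces M φ A) ⟪ A ⟫
proposition1 em ext L lt M omin φ A (q , χ , d , A≐χ) infinite =
  traces↣A (seed infinite) (Classical.Square.X×X↣X em ext (seed infinite))
  where open Conclusion em ext lt M omin φ A χ d A≐χ
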